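{- For each integer $r \geq 3$ there is a constant $c_r$ such that for all positive integers $n, k$, $$h(n, k, K_r) \le c_r \frac{n^2}{k^{(r-1)/(r-2)}}.$$
   Context: All graphs are finite, undirected and simple. A graph is $H$-free if it does not contain $H$ as a (not necessarily induced) subgraph. For a graph $G$ and a positive integer $k$, $h(G,k)$ is the minimum number of edges that can be deleted from $G$ so that the remaining graph is $k$-colorable. For a graph $H$ and positive integers $n,k$, $h(n,k,H)$ is the maximum of $h(G,k)$ over all $H$-free graphs $G$ on $n$ vertices. $K_r$ is the complete graph on $r$ vertices. -}

module Defs where

open import Data.Bool.Base using (Bool; true; false; T; not; _∧_)
open import Data.Bool.Properties using (T?) renaming (_≟_ to _≟ᵇ_)
open import Data.Empty using (⊥; ⊥-elim)
open import Data.Fin.Base as Fin using (Fin; zero; suc)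
open import Data.Fin.Properties as Fin using (any?; all?)
open import Data.List.Base using (List; length; filter; cartesianProduct; allFin)
open import Data.List.Properties using (length-filter; filter-≐)
open import Data.Nat.Base using (ℕ; zero; suc; _≤_; z≤n; s≤s; NonZero)
open import Data.Nat.Properties as ℕ using (≤-refl; ≤-trans; ≤-antisym)
open import Data.Product.Base using (∃; Σ-syntax; ∃-syntax; _×_; _,_; proj₁; proj₂)
open import Data.Sum.Base using (_⊎_; inj₁; inj₂)
open import Data.Vec.Functional using (head; tail) renaming ([] to []ᵛ; _∷_ to _∷ᵛ_)
open import Function.Base using (_∘_)
open import Function.Definitions using (Injective)
open import Relation.Binary.Core using (Rel)
open import Relation.Binary.Definitions using (_Respects_; Reflexive)
open import Relation.Binary.PropositionalEquality
  using (_≡_; _≢_; refl; sym; trans; cong; cong₂; subst)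
open import Relation.Nullary using (¬_; Dec; yes; no; ⌊_⌋)
open import Relation.Nullary.Decidable using (map′; ¬?; _×-dec_; _⊎-dec_; _→-dec_)
open import Relation.Unary using (Pred; Decidable)
open import Level using (0ℓ)

------------------------------------------------------------------------
-- Graphs

record Graph (n : ℕ) : Set where
  constructor mkGraph
  field
    adj    : Fin n → Fin n → Bool
    symm   : ∀ i j → adj i j ≡ adj j i
    irrefl : ∀ i → adj i i ≡ false

  Adj : Rel (Fin n) 0ℓ
  Adj i j = T (adj i j)

open Graph

private variable
  n p : ℕ

-- An edge {i , j} is listed once, as the pair (i , j) with i < j.

edge? : (G : Graph n) → Decidable (λ (ij : Fin n × Fin n) →
          proj₁ ij Fin.< proj₂ ij × Adj G (proj₁ ij) (proj₂ ij))
edge? G (i , j) = (i Fin.<? j) ×-dec T? (adj G i j)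

pairs : ∀ n → List (Fin n × Fin n)
pairs n = cartesianProduct (allFin n) (allFin n)

edges : Graph n → List (Fin n × Fin n)
edges {n} G = filter (edge? G) (pairs n)

∣E_∣ : Graph n → ℕ
∣E G ∣ = length (edges G)

infix 4 _⊆_
infixl 6 _─_

_⊆_ : Graph n → Graph n → Set
F ⊆ G = ∀ i j → Adj F i j → Adj G i j

-- Edge deletion; the vertex set is unchanged.

_─_ : Graph n → Graph n → Graph n
(G ─ F) .adj i j  = adj G i j ∧ not (adj F i j)
(G ─ F) .symm i j = cong₂ (λ a b → a ∧ not b) (symm G i j) (symm F i j)
(G ─ F) .irrefl i = cong (_∧ not (adj F i i)) (irrefl G i)

Colorable : Graph n → ℕ → Set
Colorable {n} G k = Σ[ c ∈ (Fin n → Fin k) ] (∀ i j → Adj G i j → c i ≢ c j)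

Contains : Graph p → Graph n → Set
Contains {p} {n} H G = Σ[ f ∈ (Fin p → Fin n) ]
  Injective _≡_ _≡_ f × (∀ i j → Adj H i j → Adj G (f i) (f j))

_isFreeOf_ : Graph n → Graph p → Set
G isFreeOf H = ¬ Contains H G

K : ∀ r → Graph r
K r .adj i j  = not ⌊ i Fin.≟ j ⌋
K r .symm i j with i Fin.≟ j | j Fin.≟ i
... | yes _  | yes _  = refl
... | no _   | no _   = refl
... | yes eq | no neq = ⊥-elim (neq (sym eq))
... | no neq | yes eq = ⊥-elim (neq (sym eq))
K r .irrefl i with i Fin.≟ i
... | yes _  = refl
... | no neq = ⊥-elim (neq refl)

------------------------------------------------------------------------
-- Minima and maxima of sets of natural numbers

IsMinimum IsMaximum : Pred ℕ 0ℓ → ℕ → Set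
IsMinimum P m = P m × (∀ d → P d → m ≤ d)
IsMaximum P m = P m × (∀ d → P d → d ≤ m)

minimum-unique : ∀ {P m m′} → IsMinimum P m → IsMinimum P m′ → m ≡ m′
minimum-unique (Pm , low) (Pm′ , low′) = ≤-antisym (low _ Pm′) (low′ _ Pm)

minimum-exists : ∀ {P} → Decidable P → ∃ P → ∃ (IsMinimum P)
minimum-exists {P} P? (d , Pd) with search d
  where
  search : ∀ b → ∃ (IsMinimum P) ⊎ (∀ x → P x → b ≤ x)
  search zero = inj₂ λ _ _ → z≤n
  search (suc b) with search b
  ... | inj₁ found = inj₁ found
  ... | inj₂ low with P? b
  ...   | yes Pb = inj₁ (b , Pb , low)
  ...   | no ¬Pb = inj₂ λ x Px →
            ℕ.≤∧≢⇒< (low x Px) λ b≡x → ¬Pb (subst P (sym b≡x) Px)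
... | inj₁ found = found
... | inj₂ low   = d , Pd , low

maximum-exists : ∀ {P} → Decidable P → ∃ P → ∀ b → (∀ d → P d → d ≤ b) →
                 ∃ (IsMaximum P)
maximum-exists P? (d , Pd) b up with P? b
... | yes Pb = b , Pb , up
maximum-exists {P} P? (d , Pd) zero up | no ¬P0 =
  ⊥-elim (¬P0 (subst P (ℕ.n≤0⇒n≡0 (up d Pd)) Pd))
maximum-exists {P} P? ∃P (suc b) up | no ¬Pb =
  maximum-exists P? ∃P b λ x Px →
    ℕ.≤-pred (ℕ.≤∧≢⇒< (up x Px) λ x≡b → ¬Pb (subst P x≡b Px))

------------------------------------------------------------------------
-- Exhaustive search over colourings and graphs, up to pointwise equality

private
  Searchable : (A : Set) → Rel A 0ℓ → Set₁
  Searchable A _≈_ = ∀ {P : Pred A 0ℓ} → P Respects _≈_ → Decidable P → Dec (∃ P)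

  Pointwise : ∀ {A : Set} {m} → Rel A 0ℓ → Rel (Fin m → A) 0ℓ
  Pointwise _≈_ f g = ∀ i → f i ≈ g i

  search-Fin : ∀ {m} → Searchable (Fin m) _≡_
  search-Fin _ P? = any? P?

  search-Bool : Searchable Bool _≡_
  search-Bool {P} _ P? = map′
    (λ { (inj₁ q) → true , q ; (inj₂ q) → false , q })
    (λ { (true , q) → inj₁ q ; (false , q) → inj₂ q })
    (P? true ⊎-dec P? false)

  search-fun : ∀ {A : Set} {_≈_ : Rel A 0ℓ} → Reflexive _≈_ → Searchable A _≈_ →
               ∀ m → Searchable (Fin m → A) (Pointwise _≈_)
  search-fun r s zero {P} resp P? = map′
    (λ q → []ᵛ , q)
    (λ (f , q) → resp {f} {[]ᵛ} (λ ()) q)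
    (P? []ᵛ)
  search-fun {A} {_≈_} r s (suc m) {P} resp P? = map′
    (λ (a , g , q) → a ∷ᵛ g , q)
    (λ (f , q) → head f , tail f ,
                 resp {f} {head f ∷ᵛ tail f} (λ { zero → r ; (suc _) → r }) q)
    (s {λ a → Σ[ g ∈ (Fin m → A) ] P (a ∷ᵛ g)}
       (λ {a} {b} a≈b (g , q) →
         g , resp {a ∷ᵛ g} {b ∷ᵛ g} (λ { zero → a≈b ; (suc _) → r }) q)
       (λ a → search-fun r s m {λ g → P (a ∷ᵛ g)}
         (λ {g} {g′} g≈g′ →
           resp {a ∷ᵛ g} {a ∷ᵛ g′} (λ { zero → r ; (suc i) → g≈g′ i }))
         (λ g → P? (a ∷ᵛ g))))

_≈_ : Rel (Graph n) 0ℓ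
G ≈ G′ = ∀ i j → adj G i j ≡ adj G′ i j

≈-sym : {G G′ : Graph n} → G ≈ G′ → G′ ≈ G
≈-sym e i j = sym (e i j)

Adj-resp : {G G′ : Graph n} → G ≈ G′ → ∀ i j → Adj G i j → Adj G′ i j
Adj-resp e i j = subst T (e i j)

search-Graph : {P : Pred (Graph n) 0ℓ} → P Respects _≈_ → Decidable P → Dec (∃ P)
search-Graph {n} {P} resp P? = map′
  (λ (B , s , ir , q) → mkGraph B s ir , q)
  (λ (G , q) → adj G , symm G , irrefl G , q)
  (search-fun (λ _ → refl) (search-fun refl search-Bool n) n resp′ dec)
  where
  IsP : Pred (Fin n → Fin n → Bool) 0ℓ
  IsP B = Σ[ s ∈ (∀ i j → B i j ≡ B j i) ] Σ[ ir ∈ (∀ i → B i i ≡ false) ]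
          P (mkGraph B s ir)

  resp′ : IsP Respects Pointwise (Pointwise _≡_)
  resp′ e (s , ir , q) =
    (λ i j → trans (sym (e i j)) (trans (s i j) (e j i))) ,
    (λ i → trans (sym (e i i)) (ir i)) ,
    resp e q

  dec : Decidable IsP
  dec B with all? (λ i → all? λ j → B i j ≟ᵇ B j i) | all? (λ i → B i i ≟ᵇ false)
  ... | no ¬s | _      = no λ (s , _) → ¬s s
  ... | yes _ | no ¬ir = no λ (_ , ir , _) → ¬ir ir
  ... | yes s | yes ir = map′ (λ q → s , ir , q)
                              (λ (_ , _ , q) → resp (λ _ _ → refl) q)
                              (P? (mkGraph B s ir))

colorable? : (G : Graph n) → ∀ k → Dec (Colorable G k)
colorable? {n} G k = search-fun refl search-Fin n
  (λ e ok i j a eq → ok i j a (trans (e i) (trans eq (sym (e j)))))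
  (λ c → all? λ i → all? λ j → T? (adj G i j) →-dec ¬? (c i Fin.≟ c j))

contains? : (H : Graph p) (G : Graph n) → Dec (Contains H G)
contains? {p} H G = search-fun refl search-Fin p
  (λ e (inj , hom) →
    (λ {x} {y} eq → inj (trans (e x) (trans eq (sym (e y))))) ,
    (λ i j a → subst T (cong₂ (adj G) (e i) (e j)) (hom i j a)))
  (λ f → map′ (λ q {x} {y} → q x y) (λ q x y → q {x} {y})
             (all? λ x → all? λ y → (f x Fin.≟ f y) →-dec (x Fin.≟ y))
         ×-dec
         all? λ i → all? λ j → T? (adj H i j) →-dec T? (adj G (f i) (f j)))

_⊆?_ : (F G : Graph n) → Dec (F ⊆ G)
F ⊆? G = all? λ i → all? λ j → T? (adj F i j) →-dec T? (adj G i j)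

∣E∣-cong : {G G′ : Graph n} → G ≈ G′ → ∣E G ∣ ≡ ∣E G′ ∣
∣E∣-cong {n} {G} {G′} e = cong length (filter-≐ (edge? G) (edge? G′)
  ( (λ { {i , j} (l , a) → l , Adj-resp {G = G} {G′} e i j a })
  , (λ { {i , j} (l , a) → l , Adj-resp {G = G′} {G} (≈-sym {G = G} {G′} e) i j a }))
  (pairs n))

Colorable-resp : ∀ k {G G′ : Graph n} → G ≈ G′ → Colorable G k → Colorable G′ k
Colorable-resp k {G} {G′} e (c , ok) =
  c , λ i j a → ok i j (Adj-resp {G = G′} {G} (≈-sym {G = G} {G′} e) i j a)

------------------------------------------------------------------------
-- h(G,k)

-- d edges can be deleted from G so that the remaining graph is k-colourable.
Deletable : Graph n → ℕ → Pred ℕ 0ℓ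
Deletable {n} G k d = Σ[ F ∈ Graph n ] F ⊆ G × Colorable (G ─ F) k × ∣E F ∣ ≡ d

deletable? : (G : Graph n) → ∀ k → Decidable (Deletable G k)
deletable? G k d = search-Graph
  (λ {F} {F′} e (sub , col , eq) →
    (λ i j a → sub i j (Adj-resp {G = F′} {F} (≈-sym {G = F} {F′} e) i j a)) ,
    Colorable-resp k {G ─ F} {G ─ F′}
      (λ i j → cong (λ b → adj G i j ∧ not b) (e i j)) col ,
    trans (sym (∣E∣-cong {G = F} {F′} e)) eq)
  (λ F → (F ⊆? G) ×-dec colorable? (G ─ F) k ×-dec (∣E F ∣ ℕ.≟ d))

Deletable-resp : ∀ k {d} {G G′ : Graph n} → G ≈ G′ → Deletable G k d → Deletable G′ k d
Deletable-resp k {G = G} {G′} e (F , sub , col , eq) =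
  F ,
  (λ i j a → Adj-resp {G = G} {G′} e i j (sub i j a)) ,
  Colorable-resp k {G ─ F} {G′ ─ F} (λ i j → cong (_∧ not (adj F i j)) (e i j)) col ,
  eq

deleteAll : (G : Graph n) → ∀ k .{{_ : NonZero k}} → Deletable G k ∣E G ∣
deleteAll G (suc k) =
  G , (λ _ _ a → a) , ((λ _ → zero) , λ i j a → ⊥-elim (b∧¬b (adj G i j) a)) , refl
  where
  b∧¬b : ∀ b → T (b ∧ not b) → ⊥
  b∧¬b true  ()
  b∧¬b false ()

abstract
  h-exists : (G : Graph n) → ∀ k .{{_ : NonZero k}} → ∃ (IsMinimum (Deletable G k))
  h-exists G k = minimum-exists (deletable? G k) (∣E G ∣ , deleteAll G k)

h : Graph n → ∀ k → .{{_ : NonZero k}} → ℕ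
h G k = proj₁ (h-exists G k)

h-isMinimum : (G : Graph n) → ∀ k .{{_ : NonZero k}} → IsMinimum (Deletable G k) (h G k)
h-isMinimum G k = proj₂ (h-exists G k)

h-cong : ∀ k .{{_ : NonZero k}} {G G′ : Graph n} → G ≈ G′ → h G k ≡ h G′ k
h-cong k {G} {G′} e = ≤-antisym
  (proj₂ (h-isMinimum G k) _ (Deletable-resp k {G = G′} {G} (≈-sym {G = G} {G′} e)
    (proj₁ (h-isMinimum G′ k))))
  (proj₂ (h-isMinimum G′ k) _ (Deletable-resp k {G = G} {G′} e
    (proj₁ (h-isMinimum G k))))

h≤∣pairs∣ : (G : Graph n) → ∀ k .{{_ : NonZero k}} → h G k ≤ length (pairs n)
h≤∣pairs∣ {n} G k = ≤-trans (proj₂ (h-isMinimum G k) _ (deleteAll G k))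
                           (length-filter (edge? G) (pairs n))

------------------------------------------------------------------------
-- h(n,k,H)

FreeValue : ∀ n k .{{_ : NonZero k}} → Graph p → Pred ℕ 0ℓ
FreeValue n k H d = Σ[ G ∈ Graph n ] G isFreeOf H × h G k ≡ d

freeValue? : ∀ n k .{{_ : NonZero k}} (H : Graph p) → Decidable (FreeValue n k H)
freeValue? n k H d = search-Graph
  (λ {G} {G′} e (free , eq) →
    (λ (f , inj , hom) → free (f , inj , λ i j a →
      Adj-resp {G = G′} {G} (≈-sym {G = G} {G′} e) (f i) (f j) (hom i j a))) ,
    trans (sym (h-cong k {G} {G′} e)) eq)
  (λ G → ¬? (contains? H G) ×-dec (h G k ℕ.≟ d))

-- The value 0 is added only so that the maximum exists when no graph on n
-- vertices is H-free; by hmax-isMaximum it plays no role otherwise.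
abstract
  hmax-exists : ∀ n k .{{_ : NonZero k}} (H : Graph p) →
                ∃ (IsMaximum (λ d → FreeValue n k H d ⊎ d ≡ 0))
  hmax-exists n k H = maximum-exists
    (λ d → freeValue? n k H d ⊎-dec (d ℕ.≟ 0))
    (0 , inj₂ refl)
    (length (pairs n))
    λ { d (inj₁ (G , _ , eq)) → subst (_≤ length (pairs n)) eq (h≤∣pairs∣ G k)
      ; d (inj₂ eq) → subst (_≤ length (pairs n)) (sym eq) z≤n }

hmax : ∀ n k → .{{_ : NonZero k}} → Graph p → ℕ
hmax n k H = proj₁ (hmax-exists n k H)

hmax-isMaximum : ∀ n k .{{_ : NonZero k}} (H : Graph p) →
                 ∃[ G ] (_isFreeOf_ {n} G H) →
                 IsMaximum (FreeValue n k H) (hmax n k H)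
hmax-isMaximum n k H (G , free) with hmax-exists n k H
... | m , inj₁ v , up = v , λ d v′ → up d (inj₁ v′)
... | _ , inj₂ refl , up =
  (G , free , ℕ.n≤0⇒n≡0 (up _ (inj₁ (G , free , refl)))) , λ d v′ → up d (inj₁ v′)

edgeless : ∀ n → Graph n
edgeless n = mkGraph (λ _ _ → false) (λ _ _ → refl) (λ _ → refl)

edgeless-K-free : ∀ n r → 2 ≤ r → edgeless n isFreeOf K r
edgeless-K-free n (suc (suc r)) _ (f , _ , hom) = hom zero (suc zero) _
edgeless-K-free n (suc zero) (s≤s ()) _

hmax-K-isMaximum : ∀ n k .{{_ : NonZero k}} r → 2 ≤ r →
                   IsMaximum (FreeValue n k (K r)) (hmax n k (K r))
hmax-K-isMaximum n k r 2≤r =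
  hmax-isMaximum n k (K r) (edgeless n , edgeless-K-free n r 2≤r)

{-# OPTIONS --safe #-}
module Submission where

-- By induction on s, a K_{s+2}-free graph on n vertices has, for every t ≥ 1, a
-- colouring with O(t^s) colours and O(n² / t^{s+1}) monochromatic edges. If n < t,
-- give every vertex its own colour. Otherwise put d = ⌊n / t⌋. While some vertex
-- has degree at least d, take d of its neighbours: they induce a K_{s+1}-free graph
-- and, by induction, can be coloured with O(t^{s-1}) new colours at the cost of
-- O(d² / t^s) edges. This happens at most 2t times. The remaining graph has at most
-- nd edges, and a greedy colouring with t^s colours makes at most a fraction 1 /
-- t^s of them monochromatic. The theorem follows on choosing t of order k^{1/s},
-- where s = r - 2.

open import Defs
open import Data.Nat.Base using (ℕ; _≤_; _*_; _^_; _∸_; NonZero)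
open import Data.Product.Base using (∃-syntax)

open import Data.Bool.Base using (T; false; not; _∧_)
open import Data.Bool.Properties using (T?; T-∧)
open import Data.Fin.Base as Fin using (Fin; zero; suc)
open import Data.Fin.Properties as Fin using ()
open import Data.List.Base
  using (List; []; _∷_; [_]; _++_; length; map; concat; concatMap; filter; replicate;
         lookup; cartesianProduct; allFin)
open import Data.List.Properties
  using (filter-++; length-++; length-map; length-replicate; concat-++; concat-map-[_];
         ++-identityʳ; map-++; length-tabulate)
open import Data.List.Membership.Propositional using (_∈_; find; lose)
open import Data.List.Membership.Propositional.Properties
  using (∈-∃++; ∈-++⁺ˡ; ∈-++⁺ʳ; ∈-map⁺; ∈-lookup; ∈-filter⁺; ∈-filter⁻;
         ∈-concatMap⁺; ∈-concat⁻; ∈-allFin)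
open import Data.List.Relation.Binary.Permutation.Propositional
  using (_↭_; prep; ↭-refl; ↭-sym; ↭-trans; ↭-reflexive)
open import Data.List.Relation.Binary.Permutation.Propositional.Properties
  using (∈-resp-↭; ↭-length; shift; ++⁺; ++⁺ˡ; filter-↭)
open import Data.List.Relation.Unary.All as All using (All; []; _∷_)
open import Data.List.Relation.Unary.All.Properties using (¬Any⇒All¬)
open import Data.List.Relation.Unary.AllPairs using (AllPairs; []; _∷_)
open import Data.List.Relation.Unary.Any as Any using (Any; here; there; any?)
open import Data.List.Relation.Unary.Any.Properties using (lookup-index)
open import Data.List.Relation.Unary.Unique.Propositional using (Unique)
import Data.List.Relation.Unary.Unique.Propositional.Properties as Unique
open import Data.Nat.Base using (zero; suc; _+_; _<_; z≤n; s≤s; s≤s⁻¹; z<s; _/_; _%_; >-nonZero)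
open import Data.Nat.DivMod using (m≡m%n+[m/n]*n; m%n<n; m/n*n≤m; m≥n⇒m/n>0)
open import Data.Nat.ListAction using (sum)
open import Data.Nat.ListAction.Properties using (sum-++)
open import Data.Nat.Properties
open import Data.Nat.Tactic.RingSolver using (solve-∀)
open import Data.Product.Base using (_×_; _,_; proj₁; proj₂; swap)
open import Data.Sum.Base as Sum using (_⊎_; inj₁; inj₂; [_,_]′)
open import Function.Base using (_∘_)
open import Function.Bundles using (Equivalence)
open import Level using (0ℓ)
open import Relation.Binary.Core using (Rel)
open import Relation.Binary.Definitions as B using ()
open import Relation.Binary.PropositionalEquality as ≡
  using (_≡_; _≢_; cong; cong₂; subst)
open import Relation.Nullary using (¬_; yes; no; ⌊_⌋; contradiction)
open import Relation.Nullary.Decidable using (toWitness; fromWitness; toWitnessFalse)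
open import Relation.Unary as U using (Pred)

-- Lists up to permutation

module _ {A : Set} where

  -- Exactly `d` elements are split off even if more satisfy `P`, so that all neighbourhoods removed
  -- in `peel` have the same size and the same cost bound.
  extract : ∀ {P : Pred A 0ℓ} (P? : U.Decidable P) xs d → d ≤ length (filter P? xs) →
            ∃[ ys ] ∃[ zs ] length ys ≡ d × All P ys × xs ↭ ys ++ zs
  extract P? xs zero _ = [] , xs , ≡.refl , [] , ↭-refl
  extract P? (x ∷ xs) (suc d) d≤ with P? x
  ... | yes Px = let ys , zs , len , Pys , p = extract P? xs d (s≤s⁻¹ d≤) in
    x ∷ ys , zs , cong suc len , Px ∷ Pys , prep x p
  ... | no  _  = let ys , zs , len , Pys , p = extract P? xs (suc d) d≤ in
    ys , x ∷ zs , len , Pys , ↭-trans (prep x p) (↭-sym (shift x ys zs))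

  -- The head of `xs` is cut out of `ys` at an occurrence; uniqueness keeps the rest of `xs` inside
  -- what is left.
  Unique-⊆⇒length≤ : ∀ {xs ys : List A} → Unique xs → (∀ {x} → x ∈ xs → x ∈ ys) →
                     length xs ≤ length ys
  Unique-⊆⇒length≤ [] _ = z≤n
  Unique-⊆⇒length≤ {x ∷ xs} (x∉xs ∷ u) sub with ∈-∃++ (sub (here ≡.refl))
  ... | as , bs , ≡.refl = begin
    suc (length xs)            ≤⟨ s≤s (Unique-⊆⇒length≤ u sub′) ⟩
    length (x ∷ as ++ bs)      ≡⟨ ↭-length (shift x as bs) ⟨
    length (as ++ [ x ] ++ bs) ∎
    where
    open ≤-Reasoning
    sub′ : ∀ {y} → y ∈ xs → y ∈ as ++ bs
    sub′ y∈ with ∈-resp-↭ (shift x as bs) (sub (there y∈))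
    ... | here y≡x  = contradiction (≡.sym y≡x) (All.lookup x∉xs y∈)
    ... | there y∈′ = y∈′

-- Constants and arithmetic

-- The closed forms are `2 ^ suc s ∸ 1` and `2 ^ s ∸ 1`. In both recursions the doubling comes from
-- the `2 * t` neighbourhoods and the 1 from the final greedy colouring.
colours weight : ℕ → ℕ
colours zero    = 1
colours (suc s) = 2 * colours s + 1
weight zero    = 0
weight (suc s) = 2 * weight s + 1

-- The power of two pays for passing from `t` to `suc t`, the inner factor 2 is the loss in `h-≤`,
-- and the summand 1 keeps the constant positive for the case `t = 0`.
constant : ℕ → ℕ
constant s = 2 ^ suc s * (2 * weight s + 1)

colours>0 : ∀ s → 0 < colours s
colours>0 zero    = z<s
colours>0 (suc s) = m≤n+m 1 (2 * colours s)

constant>0 : ∀ s → 0 < constant s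
constant>0 s = *-mono-≤ (m^n>0 2 (suc s)) (m≤n+m 1 (2 * weight s))

^-distribʳ-* : ∀ m n o → (m * n) ^ o ≡ m ^ o * n ^ o
^-distribʳ-* m n zero    = ≡.refl
^-distribʳ-* m n (suc o) = ≡.trans (cong (m * n *_) (^-distribʳ-* m n o))
  ([m*n]*[o*p]≡[m*o]*[n*p] m n (m ^ o) (n ^ o))

-- With `f t = b * t ^ s` this stands in for the `s`-th root of `k / b`, rounded down.
bracket : ∀ (f : ℕ → ℕ) k m → f 0 ≤ k → k < f m → ∃[ t ] f t ≤ k × k < f (suc t)
bracket f k zero    f0≤k k<f0 = contradiction f0≤k (<⇒≱ k<f0)
bracket f k (suc m) f0≤k k<f with k <? f m
... | yes k<fm = bracket f k m f0≤k k<fm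
... | no  k≮fm = m , ≮⇒≥ k≮fm , k<f

length-cartesianProduct : ∀ {A B : Set} (xs : List A) (ys : List B) →
                          length (cartesianProduct xs ys) ≡ length xs * length ys
length-cartesianProduct []       ys = ≡.refl
length-cartesianProduct (x ∷ xs) ys = ≡.trans (length-++ (map (x ,_) ys))
  (cong₂ _+_ (length-map (x ,_) ys) (length-cartesianProduct xs ys))

-- Partitions into colour classes

module Partitions {A : Set} {R : Rel A 0ℓ} (R? : B.Decidable R) where

  degree : A → List A → ℕ
  degree x ys = length (filter (R? x) ys)

  edgeCount : List A → ℕ
  edgeCount []       = 0
  edgeCount (x ∷ xs) = degree x xs + edgeCount xs

  monochromatic : List (List A) → ℕ
  monochromatic = sum ∘ map edgeCount

  -- For irreflexive `R`, the condition `AllPairs R ks` already makes the entries of `ks` distinct.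
  CliqueFree : ℕ → List A → Set
  CliqueFree r xs = ∀ ks → length ks ≡ r → All (_∈ xs) ks → ¬ AllPairs R ks

  -- A colouring with at most q colours and at most m / k monochromatic edges; the
  -- division is cleared.
  record Partition (xs : List A) (q k m : ℕ) : Set where
    constructor mkPartition
    field
      classes   : List (List A)
      few       : length classes ≤ q
      covers    : concat classes ↭ xs
      sparse    : monochromatic classes * k ≤ m

  relax : ∀ {xs q q′ k m m′} → q ≤ q′ → m ≤ m′ → Partition xs q k m → Partition xs q′ k m′
  relax q≤ m≤ (mkPartition c f p s) = mkPartition c (≤-trans f q≤) p (≤-trans s m≤)

  join : ∀ {xs ys zs q q′ k m m′} → xs ↭ ys ++ zs →
         Partition ys q k m → Partition zs q′ k m′ → Partition xs (q + q′) k (m + m′)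
  join {k = k} {m} {m′} xs↭ (mkPartition c f p s) (mkPartition c′ f′ p′ s′) = mkPartition (c ++ c′)
    (≤-trans (≤-reflexive (length-++ c)) (+-mono-≤ f f′))
    (↭-trans (↭-reflexive (≡.sym (concat-++ c c′))) (↭-trans (++⁺ p p′) (↭-sym xs↭)))
    (begin
      sum (map edgeCount (c ++ c′)) * k              ≡⟨ cong (λ l → sum l * k) (map-++ edgeCount c c′) ⟩
      sum (map edgeCount c ++ map edgeCount c′) * k  ≡⟨ cong (_* k) (sum-++ (map edgeCount c) _) ⟩
      (monochromatic c + monochromatic c′) * k       ≡⟨ *-distribʳ-+ k (monochromatic c) _ ⟩
      monochromatic c * k + monochromatic c′ * k     ≤⟨ +-mono-≤ s s′ ⟩
      m + m′                                         ∎)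
    where open ≤-Reasoning

  discrete : ∀ xs k → Partition xs (length xs) k 0
  discrete xs k = mkPartition (map [_] xs) (≤-reflexive (length-map [_] xs))
    (↭-reflexive (concat-map-[ xs ])) (≤-reflexive (cong (_* k) (none xs)))
    where
    none : ∀ xs → monochromatic (map [_] xs) ≡ 0
    none []       = ≡.refl
    none (_ ∷ xs) = none xs

  -- Greedy colouring

  degree-++ : ∀ v xs ys → degree v (xs ++ ys) ≡ degree v xs + degree v ys
  degree-++ v xs ys = ≡.trans (cong length (filter-++ (R? v) xs ys)) (length-++ (filter (R? v) xs))

  -- By averaging: `v` joins a class containing the fewest of its neighbours, and `m` is that least
  -- number. The recursion compares the first class with the best of the others.
  insert : ∀ v c cs → ∃[ ds ] ∃[ m ]
    length ds ≡ length (c ∷ cs) × concat ds ↭ v ∷ concat (c ∷ cs) ×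
    monochromatic ds ≡ m + monochromatic (c ∷ cs) ×
    m * length (c ∷ cs) ≤ degree v (concat (c ∷ cs))
  insert v c [] = (v ∷ c) ∷ [] , degree v c , ≡.refl , ↭-refl ,
    +-assoc (degree v c) (edgeCount c) 0 ,
    ≤-reflexive (≡.trans (*-identityʳ _) (cong (degree v) (≡.sym (++-identityʳ c))))
  insert v c (c′ ∷ cs) with insert v c′ cs
  ... | ds , m , len , p , mono , m≤ with ≤-total (degree v c) m
  ... | inj₁ d≤m = (v ∷ c) ∷ c′ ∷ cs , degree v c , ≡.refl , ↭-refl ,
    +-assoc (degree v c) (edgeCount c) _ ,
    (begin
      degree v c * (1 + length (c′ ∷ cs))           ≡⟨ *-suc (degree v c) _ ⟩
      degree v c + degree v c * length (c′ ∷ cs)    ≤⟨ +-monoʳ-≤ (degree v c) (*-monoˡ-≤ (length (c′ ∷ cs)) d≤m) ⟩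
      degree v c + m * length (c′ ∷ cs)             ≤⟨ +-monoʳ-≤ (degree v c) m≤ ⟩
      degree v c + degree v (concat (c′ ∷ cs))      ≡⟨ degree-++ v c _ ⟨
      degree v (concat (c ∷ c′ ∷ cs))               ∎)
    where open ≤-Reasoning
  ... | inj₂ m≤d = c ∷ ds , m , cong suc len ,
    ↭-trans (++⁺ˡ c p) (shift v c _) ,
    ≡.trans (cong (edgeCount c +_) mono) (x∙yz≈y∙xz (edgeCount c) m _) ,
    (begin
      m * (1 + length (c′ ∷ cs))                    ≡⟨ *-suc m _ ⟩
      m + m * length (c′ ∷ cs)                      ≤⟨ +-mono-≤ m≤d m≤ ⟩
      degree v c + degree v (concat (c′ ∷ cs))      ≡⟨ degree-++ v c _ ⟨
      degree v (concat (c ∷ c′ ∷ cs))               ∎)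
    where
    open ≤-Reasoning
    x∙yz≈y∙xz : ∀ x y z → x + (y + z) ≡ y + (x + z)
    x∙yz≈y∙xz = solve-∀

  -- Each vertex is inserted after those behind it in the list, so it adds at most a fraction 1 /
  -- `q` of the edges that `edgeCount` charges to it.
  greedy : ∀ q .{{_ : NonZero q}} xs → Partition xs q q (edgeCount xs)
  greedy q@(suc q-1) xs = let cs , len , p , s = go xs in mkPartition cs (≤-reflexive len) p s
    where
    empties : ∀ q → concat (replicate q ([] {A = A})) ≡ [] × monochromatic (replicate q []) ≡ 0
    empties zero    = ≡.refl , ≡.refl
    empties (suc q) = empties q

    go : ∀ xs → ∃[ cs ] length cs ≡ q × concat cs ↭ xs × monochromatic cs * q ≤ edgeCount xs
    -- Starting from `q` empty classes makes every insertion average over exactly `q` classes.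
    go [] = replicate q [] , length-replicate q , ↭-reflexive (proj₁ (empties q)) ,
            ≤-reflexive (cong (_* q) (proj₂ (empties q)))
    go (x ∷ xs) with go xs
    ... | c ∷ cs , len , p , s with insert x c cs
    ... | ds , m , len′ , p′ , mono , m≤ = ds , ≡.trans len′ len , ↭-trans p′ (prep x p) ,
      (begin
        monochromatic ds * q                       ≡⟨ cong (_* q) mono ⟩
        (m + monochromatic (c ∷ cs)) * q           ≡⟨ *-distribʳ-+ q m _ ⟩
        m * q + monochromatic (c ∷ cs) * q         ≤⟨ +-mono-≤ (≤-trans (≤-reflexive (cong (m *_) (≡.sym len))) m≤) s ⟩
        degree x (concat (c ∷ cs)) + edgeCount xs  ≡⟨ cong (_+ edgeCount xs) (↭-length (filter-↭ (R? x) p)) ⟩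
        degree x xs + edgeCount xs                 ∎)
      where open ≤-Reasoning

  -- Degrees, cliques and the removal of neighbourhoods

  degree-∷ : ∀ v x xs → degree v xs ≤ degree v (x ∷ xs)
  degree-∷ v x xs = ≤-trans (m≤n+m _ _) (≤-reflexive (≡.sym (degree-++ v [ x ] xs)))

  edgeCount-≤ : ∀ d xs → All (λ x → degree x xs ≤ d) xs → edgeCount xs ≤ length xs * d
  edgeCount-≤ d [] _ = z≤n
  edgeCount-≤ d (x ∷ xs) (h ∷ hs) = +-mono-≤ (≤-trans (degree-∷ x x xs) h)
    (edgeCount-≤ d xs (All.map (λ {y} → ≤-trans (degree-∷ y x xs)) hs))

  edgeless⇒edgeCount≡0 : ∀ xs → CliqueFree 2 xs → edgeCount xs ≡ 0
  edgeless⇒edgeCount≡0 [] _ = ≡.refl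
  edgeless⇒edgeCount≡0 (x ∷ xs) free = cong₂ _+_ (isolated xs there)
    (edgeless⇒edgeCount≡0 xs λ ks len ks∈ → free ks len (All.map there ks∈))
    where
    isolated : ∀ ys → (∀ {y} → y ∈ ys → y ∈ x ∷ xs) → degree x ys ≡ 0
    isolated [] _ = ≡.refl
    isolated (y ∷ ys) sub with R? x y
    ... | yes xy = contradiction ((xy ∷ []) ∷ [] ∷ [])
                     (free (x ∷ y ∷ []) ≡.refl (here ≡.refl ∷ sub (here ≡.refl) ∷ []))
    ... | no  _  = isolated ys (sub ∘ there)

  CliqueFree-mono : ∀ {r xs ys} → (∀ {x} → x ∈ ys → x ∈ xs) → CliqueFree r xs → CliqueFree r ys
  CliqueFree-mono sub free ks len ks∈ = free ks len (All.map sub ks∈)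

  -- Adding `v` to a clique among its neighbours gives a clique with one more vertex.
  neighbourhood-CliqueFree : ∀ {r v xs ys} → v ∈ xs → (∀ {x} → x ∈ ys → x ∈ xs) → All (R v) ys →
                             CliqueFree (suc r) xs → CliqueFree r ys
  neighbourhood-CliqueFree v∈ sub Rv free ks len ks∈ pairs = free (_ ∷ ks) (cong suc len)
    (v∈ ∷ All.map sub ks∈) (All.map (All.lookup Rv) ks∈ ∷ pairs)

  -- As long as some vertex has degree at least d, colour d of its neighbours with b
  -- fresh colours; afterwards colour greedily.
  peel : ∀ {r b k m} d .{{_ : NonZero d}} .{{_ : NonZero k}} →
         (∀ ys → length ys ≡ d → CliqueFree r ys → Partition ys b k m) →
         ∀ i zs → length zs ≤ i * d → CliqueFree (suc r) zs →
         Partition zs (i * b + k) k (i * m + length zs * d)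
  peel {r} {b} {k} {m} d nbhd i zs len free with any? (λ v → d ≤? degree v zs) zs
  ... | no none = relax (m≤n+m _ _)
    (≤-trans (edgeCount-≤ d zs (All.map (≰⇒≥) (¬Any⇒All¬ zs none))) (m≤n+m _ _))
    (greedy k zs)
  -- `i` bounds the number of rounds left; at zero no vertex remains, so none can have large degree.
  peel {k = k} d nbhd zero [] len free | yes ()
  peel {b = b} {k} {m} d nbhd (suc i) zs len free | yes some with find some
  ... | v , v∈zs , d≤ with extract (R? v) zs d d≤
  ... | ys , rest , ∣ys∣≡d , Rys , p =
    relax (≤-reflexive (≡.sym (+-assoc b (i * b) k)))
      (begin
        m + (i * m + length rest * d)  ≡⟨ +-assoc m (i * m) _ ⟨
        suc i * m + length rest * d    ≤⟨ +-monoʳ-≤ (suc i * m) (*-monoˡ-≤ d ∣rest∣≤) ⟩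
        suc i * m + length zs * d      ∎)
      (join p
        (nbhd ys ∣ys∣≡d (neighbourhood-CliqueFree v∈zs (∈-resp-↭ (↭-sym p) ∘ ∈-++⁺ˡ) Rys free))
        -- The `d` vertices of `ys` have left the list, which uses up one round.
        (peel d nbhd i rest (+-cancelˡ-≤ d _ _ (≤-trans (≤-reflexive (≡.sym ∣zs∣≡)) len))
          (CliqueFree-mono (∈-resp-↭ (↭-sym p) ∘ ∈-++⁺ʳ ys) free)))
    where
    open ≤-Reasoning
    ∣zs∣≡ : length zs ≡ d + length rest
    ∣zs∣≡ = ≡.trans (↭-length p) (≡.trans (length-++ ys) (cong (_+ length rest) ∣ys∣≡d))
    ∣rest∣≤ : length rest ≤ length zs
    ∣rest∣≤ = ≤-trans (m≤n+m _ d) (≤-reflexive (≡.sym ∣zs∣≡))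

  -- Listing the monochromatic edges

  edgePairs : List A → List (A × A)
  edgePairs []       = []
  edgePairs (x ∷ xs) = map (x ,_) (filter (R? x) xs) ++ edgePairs xs

  length-edgePairs : ∀ xs → length (edgePairs xs) ≡ edgeCount xs
  length-edgePairs []       = ≡.refl
  length-edgePairs (x ∷ xs) = ≡.trans (length-++ (map (x ,_) (filter (R? x) xs)))
    (cong₂ _+_ (length-map (x ,_) (filter (R? x) xs)) (length-edgePairs xs))

  length-concatMap-edgePairs : ∀ cs → length (concatMap edgePairs cs) ≡ monochromatic cs
  length-concatMap-edgePairs []       = ≡.refl
  length-concatMap-edgePairs (c ∷ cs) = ≡.trans (length-++ (edgePairs c))
    (cong₂ _+_ (length-edgePairs c) (length-concatMap-edgePairs cs))

  -- The orientation of a listed edge is the order of its ends in `xs`, hence the two alternatives.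
  ∈-edgePairs : ∀ {x y xs} → x ≢ y → x ∈ xs → y ∈ xs → R x y → R y x →
                (x , y) ∈ edgePairs xs ⊎ (y , x) ∈ edgePairs xs
  ∈-edgePairs x≢y (here ≡.refl) (here y≡x) _ _ = contradiction (≡.sym y≡x) x≢y
  ∈-edgePairs x≢y (here ≡.refl) (there y∈) xy _ =
    inj₁ (∈-++⁺ˡ (∈-map⁺ _ (∈-filter⁺ (R? _) y∈ xy)))
  ∈-edgePairs x≢y (there x∈) (here ≡.refl) _ yx =
    inj₂ (∈-++⁺ˡ (∈-map⁺ _ (∈-filter⁺ (R? _) x∈ yx)))
  ∈-edgePairs x≢y (there x∈) (there y∈) xy yx =
    Sum.map (∈-++⁺ʳ _) (∈-++⁺ʳ _) (∈-edgePairs x≢y x∈ y∈ xy yx)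

  -- Induction on the clique size

  CliqueFree⇒Partition : ∀ s t .{{_ : NonZero t}} xs → CliqueFree (2 + s) xs →
    Partition xs (colours s * t ^ s) (t ^ suc s) (weight s * length xs ^ 2)
  CliqueFree⇒Partition zero t xs free = mkPartition (xs ∷ []) ≤-refl
    (↭-reflexive (++-identityʳ xs)) (≤-reflexive (cong (λ e → (e + 0) * t ^ 1) (edgeless⇒edgeCount≡0 xs free)))
  CliqueFree⇒Partition (suc s) t xs free with t ≤? length xs
  -- Here `length xs / t` would be 0, but there are few enough vertices for a colour each.
  ... | no t≰n = relax n≤ z≤n (discrete xs (t ^ (2 + s)))
    where
    open ≤-Reasoning
    instance
      _ = m^n≢0 t s
      _ = >-nonZero (colours>0 (suc s))
    n≤ : length xs ≤ colours (suc s) * t ^ suc s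
    n≤ = begin
      length xs                     ≤⟨ ≰⇒≥ t≰n ⟩
      t                             ≤⟨ m≤m*n t (t ^ s) ⟩
      t ^ suc s                     ≤⟨ m≤n*m (t ^ suc s) (colours (suc s)) ⟩
      colours (suc s) * t ^ suc s   ∎
  ... | yes t≤n =
    -- The induction hypothesis and the greedy colouring with `t ^ suc s` colours both have the
    -- divisor `t ^ suc s`, so their costs add up.
    let mkPartition cs f p e = peel {b = colours s * t ^ s} {t ^ suc s} {weight s * d ^ 2} d
          (λ ys len free′ → relax ≤-refl (≤-reflexive (cong (λ l → weight s * l ^ 2) len))
            (CliqueFree⇒Partition s t ys free′))
          (2 * t) xs n≤2td free
    in mkPartition cs (≤-trans f (≤-reflexive (few (colours s) t (t ^ s)))) p
         (bound (monochromatic cs) e)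
    where
    open ≤-Reasoning
    n d : ℕ
    n = length xs
    d = n / t
    instance
      _ = >-nonZero (m≥n⇒m/n>0 t≤n)
      _ = m^n≢0 t (suc s)
    few : ∀ b t u → 2 * t * (b * u) + t * u ≡ (2 * b + 1) * (t * u)
    few = solve-∀
    td≤n : t * d ≤ n
    td≤n = ≤-trans (≤-reflexive (*-comm t d)) (m/n*n≤m n t)
    -- The remainder is below `t`, and `t ≤ d * t` because `t ≤ n` makes `d` positive.
    n≤2td : n ≤ 2 * t * d
    n≤2td = begin
      n                ≡⟨ m≡m%n+[m/n]*n n t ⟩
      n % t + d * t    ≤⟨ +-monoˡ-≤ (d * t) (<⇒≤ (m%n<n n t)) ⟩
      t + d * t        ≤⟨ +-monoˡ-≤ (d * t) (m≤n*m t d) ⟩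
      d * t + d * t    ≡⟨ double d t ⟩
      2 * t * d        ∎
      where
      double : ∀ d t → d * t + d * t ≡ 2 * t * d
      double = solve-∀
    -- The missing factor `t` of the divisor is gained by pairing it with `d`, since `t * d ≤ n`.
    bound : ∀ e → e * t ^ suc s ≤ 2 * t * (weight s * d ^ 2) + n * d →
            e * t ^ (2 + s) ≤ weight (suc s) * n ^ 2
    bound e e≤ = begin
      e * (t * t ^ suc s)                            ≡⟨ comm₁ e t (t ^ suc s) ⟩
      t * (e * t ^ suc s)                            ≤⟨ *-monoʳ-≤ t e≤ ⟩
      t * (2 * t * (weight s * d ^ 2) + n * d)       ≡⟨ comm₂ t (weight s) d n ⟩
      2 * weight s * (t * d) ^ 2 + n * (t * d)
        ≤⟨ +-mono-≤ (*-monoʳ-≤ (2 * weight s) (^-monoˡ-≤ 2 td≤n)) (*-monoʳ-≤ n td≤n) ⟩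
      2 * weight s * n ^ 2 + n * n                   ≡⟨ comm₃ (weight s) n ⟩
      (2 * weight s + 1) * n ^ 2                     ∎
      where
      comm₁ : ∀ e t u → e * (t * u) ≡ t * (e * u)
      comm₁ = solve-∀
      -- `d * (d * 1)` is what `d ^ 2` computes to.
      comm₂ : ∀ t w d n → t * (2 * t * (w * (d * (d * 1))) + n * d) ≡ 2 * w * ((t * d) * ((t * d) * 1)) + n * (t * d)
      comm₂ = solve-∀
      comm₃ : ∀ w n → 2 * w * (n * (n * 1)) + n * n ≡ (2 * w + 1) * (n * (n * 1))
      comm₃ = solve-∀

-- From partitions to `h`

module _ {n} (G : Graph n) where
  open Graph G

  open Partitions (λ i j → T? (adj i j))

  Adj-sym : ∀ {i j} → Adj i j → Adj j i
  Adj-sym {i} {j} = subst T (symm i j)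

  Adj-irrefl : ∀ {i j} → Adj i j → i ≢ j
  Adj-irrefl {i} a ≡.refl = subst T (irrefl i) a

  -- `lookup ks` embeds `K r`: different positions hold adjacent vertices, which are distinct by
  -- irreflexivity.
  isFreeOf-K⇒CliqueFree : ∀ {r} → G isFreeOf K r → ∀ xs → CliqueFree r xs
  isFreeOf-K⇒CliqueFree free xs ks ≡.refl _ clique =
    free (lookup ks , injective , λ i j a → adjacent clique i j (toWitnessFalse a))
    where
    adjacent : ∀ {ks} → AllPairs Adj ks → ∀ i j → i ≢ j → Adj (lookup ks i) (lookup ks j)
    adjacent (a ∷ as) zero    zero    0≢0 = contradiction ≡.refl 0≢0
    adjacent (a ∷ as) zero    (suc j) _   = All.lookup a (∈-lookup j)
    adjacent (a ∷ as) (suc i) zero    _   = Adj-sym (All.lookup a (∈-lookup i))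
    adjacent (a ∷ as) (suc i) (suc j) i≢j = adjacent as i j (i≢j ∘ cong suc)

    injective : ∀ {i j} → lookup ks i ≡ lookup ks j → i ≡ j
    injective {i} {j} eq with i Fin.≟ j
    ... | yes i≡j = i≡j
    ... | no  i≢j = contradiction eq (Adj-irrefl (adjacent clique i j i≢j))

  -- The deleted graph `F` consists of the edges inside a colour class. Its edges are listed with
  -- the smaller end first, whereas `edgePairs` follows the order in the class; including both
  -- orientations costs the factor 2.
  h-≤ : ∀ k .{{_ : NonZero k}} cs → length cs ≤ k → (∀ v → v ∈ concat cs) →
        h G k ≤ 2 * monochromatic cs
  h-≤ k cs few cover = begin
    h G k                                ≤⟨ proj₂ (h-isMinimum G k) _ (F , F⊆G , (class , proper) , ≡.refl) ⟩
    ∣E F ∣                               ≤⟨ Unique-⊆⇒length≤ unique-edges edge∈ ⟩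
    length (es ++ map swap es)           ≡⟨ length-++ es ⟩
    length es + length (map swap es)     ≡⟨ cong (length es +_) (length-map swap es) ⟩
    length es + length es                ≡⟨ cong (length es +_) (+-identityʳ (length es)) ⟨
    2 * length es                        ≡⟨ cong (2 *_) (length-concatMap-edgePairs cs) ⟩
    2 * monochromatic cs                 ∎
    where
    open ≤-Reasoning

    member : ∀ v → Any (v ∈_) cs
    member v = ∈-concat⁻ cs (cover v)

    class : Fin n → Fin k
    class v = Fin.inject≤ (Any.index (member v)) few

    es : List (Fin n × Fin n)
    es = concatMap edgePairs cs

    F : Graph n
    F = mkGraph (λ i j → adj i j ∧ ⌊ class i Fin.≟ class j ⌋)
      (λ i j → cong₂ _∧_ (symm i j) (≟-sym (class i) (class j)))
      (λ i → cong (_∧ ⌊ class i Fin.≟ class i ⌋) (irrefl i))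
      where
      ≟-sym : ∀ (a b : Fin k) → ⌊ a Fin.≟ b ⌋ ≡ ⌊ b Fin.≟ a ⌋
      ≟-sym a b with a Fin.≟ b | b Fin.≟ a
      ... | yes _   | yes _   = ≡.refl
      ... | no  _   | no  _   = ≡.refl
      ... | yes a≡b | no  b≢a = contradiction (≡.sym a≡b) b≢a
      ... | no  a≢b | yes b≡a = contradiction (≡.sym b≡a) a≢b

    F⇒ : ∀ {i j} → Graph.Adj F i j → Adj i j × class i ≡ class j
    F⇒ {i} {j} a = let Gij , same = Equivalence.to (T-∧ {adj i j}) a in Gij , toWitness same

    F⊆G : F ⊆ G
    F⊆G i j = proj₁ ∘ F⇒

    proper : ∀ i j → Graph.Adj (G ─ F) i j → class i ≢ class j
    proper i j a same = T-not⇒¬T notF (Equivalence.from (T-∧ {adj i j}) (Gij , fromWitness same))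
      where
      Gij = proj₁ (Equivalence.to (T-∧ {adj i j}) a)
      notF = proj₂ (Equivalence.to (T-∧ {adj i j}) a)
      T-not⇒¬T : ∀ {b} → T (not b) → ¬ T b
      T-not⇒¬T {false} _ ()

    unique-edges : Unique (edges F)
    unique-edges = Unique.filter⁺ (edge? F) (Unique.cartesianProduct⁺ (Unique.allFin⁺ n) (Unique.allFin⁺ n))

    edge∈ : ∀ {e} → e ∈ edges F → e ∈ es ++ map swap es
    edge∈ {i , j} e∈ with F⇒ (proj₂ (proj₂ (∈-filter⁻ (edge? F) {xs = pairs n} e∈)))
    ... | Gij , same = [ ∈-++⁺ˡ , ∈-++⁺ʳ es ∘ ∈-map⁺ swap ]′ (Sum.map inCs inCs
            (∈-edgePairs (Adj-irrefl Gij) (lookup-index (member i)) j∈ Gij (Adj-sym Gij)))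
      where
      a = Any.index (member i)
      j∈ : j ∈ lookup cs a
      j∈ = subst (λ b → j ∈ lookup cs b)
             -- Equal colours come from equal class indices, so `j` lies in the class found for `i`.
             (≡.sym (Fin.inject≤-injective few few _ _ same)) (lookup-index (member j))
      inCs : ∀ {e} → e ∈ edgePairs (lookup cs a) → e ∈ es
      inCs e∈ = ∈-concatMap⁺ edgePairs {xs = cs} (lose (∈-lookup a) e∈)

  h-≤-n² : ∀ k .{{_ : NonZero k}} → h G k ≤ n ^ 2
  h-≤-n² k = ≤-trans (h≤∣pairs∣ G k) (≤-reflexive (≡.trans (length-cartesianProduct (allFin n) (allFin n))
    (≡.trans (cong (λ l → l * l) (length-tabulate {n = n} (λ i → i)))
      (cong (n *_) (≡.sym (*-identityʳ n))))))

  -- The factor has base `suc t` because `k` will be bounded above through `suc t`. For positive `t`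
  -- this follows from `suc t ≤ 2 * t`; for `t = 0` the power is 1 and the trivial bound `n ^ 2`
  -- suffices.
  h-sparse : ∀ s t k .{{_ : NonZero k}} → G isFreeOf K (2 + s) → colours s * t ^ s ≤ k →
             h G k * suc t ^ suc s ≤ constant s * n ^ 2
  h-sparse s zero k free _ = begin
    h G k * 1 ^ suc s     ≡⟨ cong (h G k *_) (^-zeroˡ (suc s)) ⟩
    h G k * 1             ≡⟨ *-identityʳ (h G k) ⟩
    h G k                 ≤⟨ h-≤-n² k ⟩
    n ^ 2                 ≤⟨ m≤n*m (n ^ 2) (constant s) ⟩
    constant s * n ^ 2    ∎
    where
    open ≤-Reasoning
    instance
      _ = >-nonZero (constant>0 s)
  h-sparse s t@(suc _) k free ct≤k with CliqueFree⇒Partition s t (allFin n) (isFreeOf-K⇒CliqueFree free _)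
  ... | mkPartition cs few p sparse = begin
    h G k * suc t ^ suc s                             ≤⟨ *-mono-≤ h≤ (^-monoˡ-≤ (suc s) 1+t≤2t) ⟩
    2 * monochromatic cs * (2 * t) ^ suc s            ≡⟨ cong (2 * monochromatic cs *_) (^-distribʳ-* 2 t (suc s)) ⟩
    2 * monochromatic cs * (2 ^ suc s * t ^ suc s)    ≡⟨ rearrange (monochromatic cs) (2 ^ suc s) (t ^ suc s) ⟩
    2 ^ suc s * (2 * (monochromatic cs * t ^ suc s))  ≤⟨ *-monoʳ-≤ (2 ^ suc s) (*-monoʳ-≤ 2 sparse) ⟩
    2 ^ suc s * (2 * (weight s * length (allFin n) ^ 2))
      ≡⟨ cong (λ l → 2 ^ suc s * (2 * (weight s * l ^ 2))) (length-tabulate {n = n} _) ⟩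
    2 ^ suc s * (2 * (weight s * n ^ 2))              ≡⟨ reassoc (2 ^ suc s) (weight s) (n ^ 2) ⟩
    2 ^ suc s * (2 * weight s) * n ^ 2                ≤⟨ *-monoˡ-≤ (n ^ 2) (*-monoʳ-≤ (2 ^ suc s) (m≤m+n (2 * weight s) 1)) ⟩
    constant s * n ^ 2                                ∎
    where
    open ≤-Reasoning
    h≤ : h G k ≤ 2 * monochromatic cs
    h≤ = h-≤ k cs (≤-trans few ct≤k) λ v → ∈-resp-↭ (↭-sym p) (∈-allFin v)
    1+t≤2t : suc t ≤ 2 * t
    1+t≤2t = +-mono-≤ (s≤s z≤n) (≤-reflexive (≡.sym (+-identityʳ t)))
    rearrange : ∀ e a b → 2 * e * (a * b) ≡ a * (2 * (e * b))
    rearrange = solve-∀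
    reassoc : ∀ a w m → a * (2 * (w * m)) ≡ a * (2 * w) * m
    reassoc = solve-∀

-- Raising the inequality to the power `r ∸ 2` and clearing the denominator turns the fractional
-- exponent of `k` into `r ∸ 1` and keeps everything in `ℕ`.
theorem1p1 : ∀ r → 3 ≤ r → ∃[ c ] (∀ n k → .{{_ : NonZero n}} → .{{_ : NonZero k}} →
    hmax n k (K r) ^ (r ∸ 2) * k ^ (r ∸ 1) ≤ (c * n ^ 2) ^ (r ∸ 2))
-- The factor `b ^ suc s` comes from raising `k < b * suc t ^ s` to the power `suc s`.
theorem1p1 (suc (suc (suc s-1))) (s≤s (s≤s (s≤s z≤n))) = b ^ suc s * constant s , bound
  where
  open ≤-Reasoning
  s b : ℕ
  s = suc s-1
  b = colours s

  instance
    _ = >-nonZero (colours>0 s)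
    _ = m^n≢0 b (suc s)
    b^≢0 = m^n≢0 (b ^ suc s) s-1

  rearrange : ∀ x y z → x * (y * z) ≡ (x * z) * y
  rearrange = solve-∀

  rearrange′ : ∀ x y z → (x * y) * z ≡ (z * x) * y
  rearrange′ = solve-∀

  bound : ∀ n k → .{{_ : NonZero n}} → .{{_ : NonZero k}} →
          hmax n k (K (2 + s)) ^ s * k ^ suc s ≤ (b ^ suc s * constant s * n ^ 2) ^ s
  -- An extremal `G` attains the maximum. The search for `t` may stop at `suc k`: as `s` and `b` are
  -- positive, `b * suc k ^ s` exceeds `k`.
  bound n k with hmax n k (K (2 + s)) | proj₁ (hmax-K-isMaximum n k (2 + s) (s≤s (s≤s z≤n)))
               | bracket (λ t → b * t ^ s) k (suc k) (≤-trans (≤-reflexive (*-zeroʳ b)) z≤n)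
                   (≤-trans (m≤m*n (suc k) (suc k ^ s-1) {{m^n≢0 (suc k) s-1}}) (m≤n*m (suc k ^ s) b))
  ... | _ | G , free , ≡.refl | t , bt≤k , k<b[1+t] = begin
    D ^ s * k ^ suc s                              ≤⟨ *-monoʳ-≤ (D ^ s) (^-monoˡ-≤ (suc s) (<⇒≤ k<b[1+t])) ⟩
    D ^ s * (b * suc t ^ s) ^ suc s                ≡⟨ cong (D ^ s *_) (^-distribʳ-* b (suc t ^ s) (suc s)) ⟩
    D ^ s * (b ^ suc s * (suc t ^ s) ^ suc s)      ≡⟨ cong (λ x → D ^ s * (b ^ suc s * x)) swapExp ⟩
    D ^ s * (b ^ suc s * (suc t ^ suc s) ^ s)      ≡⟨ rearrange (D ^ s) (b ^ suc s) _ ⟩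
    D ^ s * (suc t ^ suc s) ^ s * b ^ suc s        ≡⟨ cong (_* b ^ suc s) (^-distribʳ-* D (suc t ^ suc s) s) ⟨
    (D * suc t ^ suc s) ^ s * b ^ suc s
      -- Enlarging `b ^ suc s` to its `s`-th power lets it move inside the outer power.
      ≤⟨ *-mono-≤ (^-monoˡ-≤ s (h-sparse G s t k free bt≤k)) (m≤m*n (b ^ suc s) ((b ^ suc s) ^ s-1)) ⟩
    (constant s * n ^ 2) ^ s * (b ^ suc s) ^ s     ≡⟨ ^-distribʳ-* (constant s * n ^ 2) (b ^ suc s) s ⟨
    (constant s * n ^ 2 * b ^ suc s) ^ s           ≡⟨ cong (_^ s) (rearrange′ (constant s) (n ^ 2) (b ^ suc s)) ⟩
    (b ^ suc s * constant s * n ^ 2) ^ s           ∎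
    where
    D = h G k
    swapExp : (suc t ^ s) ^ suc s ≡ (suc t ^ suc s) ^ s
    swapExp = ≡.trans (^-*-assoc (suc t) s (suc s))
      (≡.trans (cong (suc t ^_) (*-comm s (suc s))) (≡.sym (^-*-assoc (suc t) (suc s) s)))
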